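{- Let $k\ge1$ and $t\ge 1$ be integers and let $c\colon E(K_{2kt+1})\to[k]$ be a $k$-edge-colouring of the complete graph $K_{2kt+1}$. Suppose that, for every $j\in[k]$ and every set $S\subseteq[k]$ of $j$ colours, there are strictly more than $\binom{2jt}{2}$ edges $e$ of $K_{2kt+1}$ with $c(e)\in S$. Then there exists a colour-balanced spanning tree of $K_{2kt+1}$.
   Context: $[k]=\{1,\dots,k\}$. A $k$-edge-colouring is an arbitrary (not necessarily proper) map from the edge set to $[k]$. A subgraph is colour-balanced if each of the $k$ colours appears on equally many of its edges (so a colour-balanced spanning tree of $K_{2kt+1}$ has exactly $2t$ edges of each colour). -}

module Defs where

open import Data.Bool.Base using (Bool; T)
open import Data.Bool.Properties using (T?)
open import Data.Fin.Base as Fin using (Fin)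
import Data.Fin.Properties as Fin
open import Data.Fin.Subset using (Subset)
open import Data.Fin.Subset.Properties using (_∈?_)
open import Data.List.Base
  using (List; _∷_; _∷ʳ_; allFin; cartesianProduct; filter; length; mapMaybe)
open import Data.List.Relation.Unary.Linked using (Linked)
open import Data.List.Relation.Unary.Unique.Propositional using (Unique)
open import Data.Maybe.Base using (Maybe; just; nothing)
open import Data.Nat.Base using (ℕ; _≤_)
open import Data.Product.Base using (Σ-syntax; _×_; _,_)
open import Relation.Binary.Construct.Closure.ReflexiveTransitive using (Star)
open import Relation.Binary.Construct.Closure.Symmetric using (SymClosure)
open import Relation.Binary.Core using (Rel)
open import Relation.Binary.PropositionalEquality.Core using (_≡_)
open import Relation.Nullary using (¬_; yes; no; _×-dec_)

-- An edge of the complete graph on Fin n is an unordered pair of distinct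
-- vertices, represented by its strictly increasing ordering.
record Edge (n : ℕ) : Set where
  constructor edge
  field
    lo hi  : Fin n
    .lo<hi : lo Fin.< hi

toEdge : ∀ {n} → Fin n × Fin n → Maybe (Edge n)
toEdge (u , v) with u Fin.<? v
... | yes u<v = just (edge u v u<v)
... | no  _   = nothing

-- Every edge occurs exactly once, so lengths of filtered sublists are
-- cardinalities of edge sets.
edges : ∀ n → List (Edge n)
edges n = mapMaybe toEdge (cartesianProduct (allFin n) (allFin n))

-- Not required to be proper.
EdgeColouring : ℕ → ℕ → Set
EdgeColouring n k = Edge n → Fin k

#edgesColouredIn : ∀ {n k} → EdgeColouring n k → Subset k → ℕ
#edgesColouredIn {n} c S = length (filter (λ e → c e ∈? S) (edges n))

-- A spanning subgraph contains all n vertices, so it is determined by its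
-- edge set.
SpanningSubgraph : ℕ → Set
SpanningSubgraph n = Edge n → Bool

module _ {n : ℕ} (H : SpanningSubgraph n) where

  Adjacent : Rel (Fin n) _
  Adjacent = SymClosure (λ u v → Σ[ u<v ∈ u Fin.< v ] T (H (edge u v u<v)))

  Connected : Set
  Connected = ∀ u v → Star Adjacent u v

  -- The cycle visits u, then vs, and returns to u; the bound on length vs
  -- says that it has at least three vertices.
  record Cycle : Set where
    field
      u        : Fin n
      vs       : List (Fin n)
      long     : 2 ≤ length vs
      distinct : Unique (u ∷ vs)
      closed   : Linked Adjacent (u ∷ vs ∷ʳ u)

  Acyclic : Set
  Acyclic = ¬ Cycle

  IsSpanningTree : Set
  IsSpanningTree = Connected × Acyclic

  #edgesOfColour : ∀ {k} → EdgeColouring n k → Fin k → ℕ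
  #edgesOfColour c i =
    length (filter (λ e → T? (H e) ×-dec (c e Fin.≟ i)) (edges n))

  ColourBalanced : ∀ {k} → EdgeColouring n k → Set
  ColourBalanced c = ∀ i j → #edgesOfColour c i ≡ #edgesOfColour c j

{-# OPTIONS --safe #-}

-- With d = 2t, this is Rado's theorem for the graphic matroid: a set of edges
-- with d edges of each colour and rank dk = n - 1 exists as soon as the edges
-- with colours in S have rank at least d∣S∣ for every S.  That condition holds
-- because edges of rank r number at most C(r + 1, 2).
-- Take a set H of edges minimal with this rank condition.  If H_S denotes its
-- edges with colours in S, every e in H lies in some H_S of rank exactly d∣S∣
-- from which it cannot be deleted without dropping the rank.  Uncrossing these
-- S over all edges of one colour i gives a set T containing i with
-- rank H_{T - i} + ∣H_{i}∣ ≤ d∣T∣, whence ∣H_{i}∣ ≤ d.  So H has dk edges and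
-- rank dk, and is a spanning tree.

module Submission where

open import Defs
open import Data.Nat.Base using (ℕ; _+_; _*_; _≤_; _>_)
open import Data.Nat.Combinatorics using (_C_)
open import Data.Fin.Subset using (Subset; ∣_∣)
open import Data.Product.Base using (Σ-syntax; _×_)
open import Relation.Binary.PropositionalEquality.Core using (_≡_)

open import Algebra.Properties.CommutativeSemigroup using (interchange)
open import Data.Bool.Base using (T)
open import Data.Bool.Properties using (T?)
open import Data.Fin.Base as Fin using (Fin)
import Data.Fin.Properties as Fin
open import Data.Fin.Subset using (inside; outside; _∪_; _∩_; _-_; ⁅_⁆; ⊤)
  renaming (_∈_ to _∈ₛ_)
open import Data.Fin.Subset.Properties
  using (_∈?_; anySubset?; x∈p∪q⁺; x∈p∪q⁻; x∈p∩q⁺; x∈p∩q⁻; x∈p∧x≢y⇒x∈p-y;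
         x∈⁅x⁆; x∈⁅y⁆⇒x≡y; ∣⁅x⁆∣≡1; p⊆q⇒∣p∣≤∣q∣; p─q⊆p; ∈⊤; ∣⊤∣≡n; ∣p∣≤n)
open import Data.List.Base
  using (List; []; _∷_; _∷ʳ_; _++_; allFin; cartesianProduct; concatMap; filter;
         length; map; mapMaybe)
open import Data.List.Membership.Propositional using (_∈_; _∉_; find; lose)
open import Data.List.Membership.Propositional.Properties
  using (∈-∃++; ∈-++⁺ˡ; ∈-++⁺ʳ; ∈-++⁻; ∈-filter⁺; ∈-filter⁻; ∈-map⁺; ∈-map⁻;
         ∈-allFin; ∈-cartesianProduct⁺; ∈-concatMap⁺)
open import Data.List.Properties
  using (length-++; length-map; length-tabulate; length-++-sucʳ; filter-notAll)
open import Data.List.Relation.Binary.Subset.Propositional using (_⊆_)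
open import Data.List.Relation.Unary.All as All using (All; []; _∷_)
import Data.List.Relation.Unary.All.Properties as All
open import Data.List.Relation.Unary.AllPairs as AllPairs using (AllPairs; []; _∷_)
import Data.List.Relation.Unary.AllPairs.Properties as AllPairs
open import Data.List.Relation.Unary.Any as Any using (Any; here; there)
import Data.List.Relation.Unary.Any.Properties as Any
open import Data.List.Relation.Unary.Linked using (Linked; _∷_)
open import Data.List.Relation.Unary.Unique.Propositional using (Unique)
import Data.List.Relation.Unary.Unique.Propositional.Properties as Unique
open import Data.Maybe.Base using (Maybe; just; nothing)
import Data.Maybe.Relation.Unary.All as Maybe
import Data.Maybe.Relation.Unary.Any as MaybeAny
open import Data.Nat.Base using (zero; suc; z≤n; s≤s; s≤s⁻¹; _<_)
import Data.Nat.Properties as ℕ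
open import Data.Nat.Combinatorics using (nC1≡n; nCk+nC[k+1]≡[n+1]C[k+1])
open import Data.Product.Base using (∃; _,_; proj₁; proj₂)
open import Data.Product.Properties using (,-injective)
open import Data.Sum.Base using (_⊎_; inj₁; inj₂; [_,_]′; swap)
open import Data.Vec.Base using ([]; _∷_; there)
open import Function.Base using (_∘_; id; case_of_)
open import Relation.Binary.Construct.Closure.Symmetric using (fwd; bwd)
open import Relation.Binary.Core using (Rel)
open import Relation.Binary.Structures using (IsEquivalence)
import Relation.Binary.Construct.Closure.Equivalence as Eq
open Eq using (EqClosure)
import Relation.Binary.Construct.On as On
open import Relation.Binary.PropositionalEquality.Core
  using (refl; sym; trans; cong; cong₂; subst; _≢_)
open import Relation.Binary.PropositionalEquality.Properties as ≡
open import Relation.Nullary 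
  using (¬_; Dec; yes; no; does; contradiction; recompute; _×-dec_; ¬?)
open import Relation.Nullary.Decidable using (decidable-stable; map′)

-- Counting in duplicate-free lists, binomial coefficients and subsets

Unique-⊆-length : ∀ {A : Set} {xs ys : List A} →
  Unique xs → xs ⊆ ys → length xs ≤ length ys
Unique-⊆-length [] _ = z≤n
Unique-⊆-length {xs = x ∷ xs} (x∉xs ∷ uxs) sub with ∈-∃++ (sub (here refl))
... | as , bs , refl =
  subst (suc (length xs) ≤_) (sym (length-++-sucʳ as x bs))
    (s≤s (Unique-⊆-length uxs sub′))
  where
  sub′ : xs ⊆ as ++ bs
  sub′ y∈xs with ∈-++⁻ as (sub (there y∈xs))
  ... | inj₁ y∈as = ∈-++⁺ˡ y∈as
  ... | inj₂ (here refl) = contradiction refl (All.lookup x∉xs y∈xs)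
  ... | inj₂ (there y∈bs) = ∈-++⁺ʳ as y∈bs

-- Injectivity is asked only on members of `xs`: the map `code` used later separates the edges of
-- one list, relying on their endpoints sharing a label.
Unique-map-∈ : ∀ {A B : Set} {f : A → B} {xs} →
  (∀ {x y} → x ∈ xs → y ∈ xs → f x ≡ f y → x ≡ y) → Unique xs → Unique (map f xs)
Unique-map-∈ inj [] = []
Unique-map-∈ inj (x∉ ∷ u) =
  All.map⁺ (All.tabulate λ y∈ eq → All.lookup x∉ y∈ (inj (here refl) (there y∈) eq))
    ∷ Unique-map-∈ (λ x∈ y∈ → inj (there x∈) (there y∈)) u

-- The diagonal pairs are included, which is why r elements give C(r + 1, 2); they later serve as
-- codes for edges that leave a root.
triangle : ∀ {A : Set} → List A → List (A × A)
triangle []       = []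
triangle (x ∷ xs) = map (x ,_) (x ∷ xs) ++ triangle xs

length-triangle : ∀ {A : Set} (xs : List A) →
  length (triangle xs) ≡ suc (length xs) C 2
length-triangle []       = refl
length-triangle (x ∷ xs) = begin
  length (map (x ,_) (x ∷ xs) ++ triangle xs)
    ≡⟨ length-++ (map (x ,_) (x ∷ xs)) ⟩
  length (map (x ,_) (x ∷ xs)) + length (triangle xs)
    ≡⟨ cong₂ _+_ (length-map (x ,_) (x ∷ xs)) (length-triangle xs) ⟩
  suc (length xs) + suc (length xs) C 2
    ≡⟨ cong (_+ suc (length xs) C 2) (nC1≡n (suc (length xs))) ⟨
  suc (length xs) C 1 + suc (length xs) C 2
    ≡⟨ nCk+nC[k+1]≡[n+1]C[k+1] (suc (length xs)) 1 ⟩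
  suc (suc (length xs)) C 2 ∎
  where open ≡.≡-Reasoning

∈-triangle : ∀ {n} {xs : List (Fin n)} {x y} → AllPairs Fin._<_ xs →
  x ∈ xs → y ∈ xs → x Fin.≤ y → (x , y) ∈ triangle xs
∈-triangle _ (here refl) y∈ _ = ∈-++⁺ˡ (∈-map⁺ _ y∈)
∈-triangle (y< ∷ _) (there x∈) (here refl) x≤y =
  contradiction x≤y (ℕ.<⇒≱ (All.lookup y< x∈))
∈-triangle (_ ∷ sorted) (there x∈) (there y∈) x≤y =
  ∈-++⁺ʳ (map _ _) (∈-triangle sorted x∈ y∈ x≤y)

C2-mono-≤ : ∀ {m n} → m ≤ n → m C 2 ≤ n C 2
C2-mono-≤ z≤n = z≤n
C2-mono-≤ (s≤s {m} {n} m≤n) = begin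
  suc m C 2       ≡⟨ nCk+nC[k+1]≡[n+1]C[k+1] m 1 ⟨
  m C 1 + m C 2   ≤⟨ ℕ.+-mono-≤ C1 (C2-mono-≤ m≤n) ⟩
  n C 1 + n C 2   ≡⟨ nCk+nC[k+1]≡[n+1]C[k+1] n 1 ⟩
  suc n C 2       ∎
  where
  open ℕ.≤-Reasoning
  C1 : m C 1 ≤ n C 1
  C1 = begin m C 1 ≡⟨ nC1≡n m ⟩ m ≤⟨ m≤n ⟩ n ≡⟨ nC1≡n n ⟨ n C 1 ∎

∣p∪q∣+∣p∩q∣≡∣p∣+∣q∣ : ∀ {n} (p q : Subset n) → ∣ p ∪ q ∣ + ∣ p ∩ q ∣ ≡ ∣ p ∣ + ∣ q ∣
∣p∪q∣+∣p∩q∣≡∣p∣+∣q∣ [] [] = refl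
∣p∪q∣+∣p∩q∣≡∣p∣+∣q∣ (outside ∷ p) (outside ∷ q) = ∣p∪q∣+∣p∩q∣≡∣p∣+∣q∣ p q
∣p∪q∣+∣p∩q∣≡∣p∣+∣q∣ (outside ∷ p) (inside ∷ q) =
  trans (cong suc (∣p∪q∣+∣p∩q∣≡∣p∣+∣q∣ p q)) (sym (ℕ.+-suc ∣ p ∣ ∣ q ∣))
∣p∪q∣+∣p∩q∣≡∣p∣+∣q∣ (inside ∷ p) (outside ∷ q) = cong suc (∣p∪q∣+∣p∩q∣≡∣p∣+∣q∣ p q)
∣p∪q∣+∣p∩q∣≡∣p∣+∣q∣ (inside ∷ p) (inside ∷ q) = cong suc (begin
  ∣ p ∪ q ∣ + suc ∣ p ∩ q ∣ ≡⟨ ℕ.+-suc ∣ p ∪ q ∣ ∣ p ∩ q ∣ ⟩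
  suc (∣ p ∪ q ∣ + ∣ p ∩ q ∣) ≡⟨ cong suc (∣p∪q∣+∣p∩q∣≡∣p∣+∣q∣ p q) ⟩
  suc (∣ p ∣ + ∣ q ∣) ≡⟨ ℕ.+-suc ∣ p ∣ ∣ q ∣ ⟨
  ∣ p ∣ + suc ∣ q ∣ ∎)
  where open ≡.≡-Reasoning

∣p∣≤1+∣p-x∣ : ∀ {n} (p : Subset n) x → ∣ p ∣ ≤ suc ∣ p - x ∣
∣p∣≤1+∣p-x∣ p x = begin
  ∣ p ∣                                           ≤⟨ p⊆q⇒∣p∣≤∣q∣ p⊆ ⟩
  ∣ ⁅ x ⁆ ∪ (p - x) ∣                             ≤⟨ ℕ.m≤m+n _ _ ⟩
  ∣ ⁅ x ⁆ ∪ (p - x) ∣ + ∣ ⁅ x ⁆ ∩ (p - x) ∣       ≡⟨ ∣p∪q∣+∣p∩q∣≡∣p∣+∣q∣ ⁅ x ⁆ (p - x) ⟩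
  ∣ ⁅ x ⁆ ∣ + ∣ p - x ∣                           ≡⟨ cong (_+ ∣ p - x ∣) (∣⁅x⁆∣≡1 x) ⟩
  suc ∣ p - x ∣                                   ∎
  where
  open ℕ.≤-Reasoning
  p⊆ : ∀ {y} → y ∈ₛ p → y ∈ₛ ⁅ x ⁆ ∪ (p - x)
  p⊆ {y} y∈p with y Fin.≟ x
  ... | yes refl = x∈p∪q⁺ (inj₁ (x∈⁅x⁆ x))
  ... | no y≢x   = x∈p∪q⁺ (inj₂ (x∈p∧x≢y⇒x∈p-y y∈p y≢x))

x∉p-x : ∀ {n} (p : Subset n) x → ¬ x ∈ₛ p - x
x∉p-x (outside ∷ p) Fin.zero    ()
x∉p-x (inside ∷ p)  Fin.zero    ()
x∉p-x (_ ∷ p)       (Fin.suc x) (there x∈) = x∉p-x p x x∈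

-- Edges of the complete graph and their enumeration

module _ {n : ℕ} where

  open Edge

  lo<hi′ : (e : Edge n) → lo e Fin.< hi e
  lo<hi′ (edge u v u<v) = recompute (u Fin.<? v) u<v

  edge-≡ : ∀ {e f : Edge n} → lo e ≡ lo f → hi e ≡ hi f → e ≡ f
  edge-≡ {edge _ _ _} {edge _ _ _} refl refl = refl

  infix 4 _≟_
  _≟_ : (e f : Edge n) → Dec (e ≡ f)
  e ≟ f = map′ (λ (p , q) → edge-≡ p q) (λ { refl → refl , refl })
    ((lo e Fin.≟ lo f) ×-dec (hi e Fin.≟ hi f))

  toEdge-just : ∀ {u v e} → toEdge {n} (u , v) ≡ just e → lo e ≡ u × hi e ≡ v
  toEdge-just {u} {v} eq with u Fin.<? v
  toEdge-just refl | yes _ = refl , refl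

  toEdge-lo,hi : (e : Edge n) → toEdge (lo e , hi e) ≡ just e
  toEdge-lo,hi e with lo e Fin.<? hi e
  ... | yes _ = refl
  ... | no ¬p = contradiction (lo<hi′ e) ¬p

  -- `toEdge` is partial but injective where it is defined, since an edge determines the pair it
  -- came from.
  Unique-mapMaybe-toEdge : ∀ {ps} → Unique ps → Unique (mapMaybe (toEdge {n}) ps)
  Unique-mapMaybe-toEdge [] = []
  Unique-mapMaybe-toEdge {p ∷ ps} (p∉ ∷ u) with toEdge p in eq
  ... | nothing = Unique-mapMaybe-toEdge u
  ... | just e  = All.mapMaybe⁺ (All.map⁺ (All.map distinct p∉)) ∷ Unique-mapMaybe-toEdge u
    where
    distinct : ∀ {q} → p ≢ q → Maybe.All (e ≢_) (toEdge q)
    distinct {q} p≢q with toEdge q in eq′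
    ... | nothing = Maybe.nothing
    ... | just f  = Maybe.just λ { refl → p≢q (cong₂ _,_
      (trans (sym (proj₁ (toEdge-just eq))) (proj₁ (toEdge-just eq′)))
      (trans (sym (proj₂ (toEdge-just eq))) (proj₂ (toEdge-just eq′)))) }

  edges-unique : Unique (edges n)
  edges-unique = Unique-mapMaybe-toEdge
    (Unique.cartesianProduct⁺ (Unique.allFin⁺ n) (Unique.allFin⁺ n))

  ∈-edges : (e : Edge n) → e ∈ edges n
  ∈-edges e = Any.mapMaybe⁺ toEdge _ (Any.map⁺ (Any.map found pair∈))
    where
    pair∈ : (lo e , hi e) ∈ cartesianProduct (allFin n) (allFin n)
    pair∈ = ∈-cartesianProduct⁺ (∈-allFin (lo e)) (∈-allFin (hi e))
    found : ∀ {p} → (lo e , hi e) ≡ p → MaybeAny.Any (e ≡_) (toEdge p)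
    found refl rewrite toEdge-lo,hi e = MaybeAny.just refl

  -- The graphic matroid

  upper lower : Fin n → Fin n → Fin n
  upper a b with a Fin.<? b
  ... | yes _ = b
  ... | no _  = a
  lower a b with a Fin.<? b
  ... | yes _ = a
  ... | no _  = b

  lower≤upper : ∀ a b → lower a b Fin.≤ upper a b
  lower≤upper a b with a Fin.<? b
  ... | yes a<b = ℕ.<⇒≤ a<b
  ... | no a≮b  = ℕ.≮⇒≥ a≮b

  lower≡upper⇒≡ : ∀ a b → lower a b ≡ upper a b → a ≡ b
  lower≡upper⇒≡ a b eq with a Fin.<? b
  ... | yes _ = eq
  ... | no _  = sym eq

  upper-sel : (P : Fin n → Set) → ∀ {a b} → P a → P b → P (upper a b)
  upper-sel P {a} {b} pa pb with a Fin.<? b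
  ... | yes _ = pb
  ... | no _  = pa

  -- The union step of union-find: the larger of the two labels is redirected to the smaller, so
  -- labels only decrease. For equal labels it is the identity.
  merge : Fin n → Fin n → Fin n → Fin n
  merge a b x with x Fin.≟ upper a b
  ... | yes _ = lower a b
  ... | no _  = x

  merge-upper : ∀ a b → merge a b (upper a b) ≡ lower a b
  merge-upper a b with upper a b Fin.≟ upper a b
  ... | yes _ = refl
  ... | no ¬p = contradiction refl ¬p

  merge-lower : ∀ a b → merge a b (lower a b) ≡ lower a b
  merge-lower a b with lower a b Fin.≟ upper a b
  ... | yes _ = refl
  ... | no _ = refl

  merge-identifies : ∀ a b → merge a b a ≡ merge a b b
  merge-identifies a b = case lemma of λ where
      (inj₁ (p , q)) → trans (cong (merge a b) p) (trans (trans (merge-lower a b)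
         (sym (merge-upper a b))) (cong (merge a b) (sym q)))
      (inj₂ (p , q)) → trans (cong (merge a b) p) (trans (trans (merge-upper a b)
         (sym (merge-lower a b))) (cong (merge a b) (sym q)))
    where
    lemma : (a ≡ lower a b × b ≡ upper a b) ⊎ (a ≡ upper a b × b ≡ lower a b)
    lemma with a Fin.<? b
    ... | yes _ = inj₁ (refl , refl)
    ... | no _  = inj₂ (refl , refl)

  merge-≤ : ∀ a b x → merge a b x Fin.≤ x
  merge-≤ a b x with x Fin.≟ upper a b
  ... | yes refl = lower≤upper a b
  ... | no _     = ℕ.≤-refl

  merge-moves : ∀ a b x → merge a b x ≢ x → x ≡ upper a b
  merge-moves a b x moved with x Fin.≟ upper a b
  ... | yes eq = eq
  ... | no _   = contradiction refl moved

  merge-sound : ∀ {ℓ} {R : Rel (Fin n) ℓ} → IsEquivalence R →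
    ∀ {a b} → R a b → ∀ x → R x (merge a b x)
  merge-sound {R = R} eqv {a} {b} Rab x with x Fin.≟ upper a b
  ... | no _     = IsEquivalence.refl eqv
  ... | yes refl with a Fin.<? b
  ...   | yes _ = IsEquivalence.sym eqv Rab
  ...   | no _  = Rab

  -- label es v is the least vertex of the component of v.
  label : List (Edge n) → Fin n → Fin n
  label []       v = v
  label (e ∷ es) v = merge (label es (lo e)) (label es (hi e)) (label es v)

  infix 4 _spans_
  -- Membership of `e` in the matroid closure of `es`: its ends lie in one component.
  _spans_ : List (Edge n) → Edge n → Set
  es spans e = label es (lo e) ≡ label es (hi e)

  spans? : ∀ es e → Dec (es spans e)
  spans? es e = label es (lo e) Fin.≟ label es (hi e)

  label-joins : ∀ es {e} → e ∈ es → es spans e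
  label-joins (e ∷ es) (here refl) = merge-identifies (label es (lo e)) (label es (hi e))
  label-joins (e ∷ es) (there e∈)  = cong (merge _ _) (label-joins es e∈)

  -- Labels change only along edges of `es`, so any equivalence containing these edges relates a
  -- vertex to its label. Taking for `R` the kernel of another labelling compares components; taking
  -- walks in a subgraph gives connectedness.
  label-sound : ∀ {ℓ} {R : Rel (Fin n) ℓ} → IsEquivalence R → ∀ es →
    (∀ {e} → e ∈ es → R (lo e) (hi e)) → ∀ v → R v (label es v)
  label-sound eqv [] _ v = IsEquivalence.refl eqv
  label-sound {R = R} eqv (e ∷ es) Res v = R.trans (ih v) (merge-sound eqv
      (R.trans (R.sym (ih (lo e))) (R.trans (Res (here refl)) (ih (hi e)))) (label es v))
    where
    module R = IsEquivalence eqv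
    ih = label-sound eqv es (Res ∘ there)

  label-coarsens : ∀ as bs → (∀ {e} → e ∈ as → bs spans e) →
    ∀ v → label bs v ≡ label bs (label as v)
  label-coarsens as bs sp = label-sound (On.isEquivalence (label bs) ≡.isEquivalence) as sp

  spans-trans : ∀ as bs {e} → (∀ {f} → f ∈ as → bs spans f) → as spans e → bs spans e
  spans-trans as bs {e} sp eq = trans (label-coarsens as bs sp (lo e))
    (trans (cong (label bs) eq) (sym (label-coarsens as bs sp (hi e))))

  label-idem : ∀ es v → label es (label es v) ≡ label es v
  label-idem es v = sym (label-coarsens es es (label-joins es) v)

  label-≤ : ∀ es v → label es v Fin.≤ v
  label-≤ [] v = ℕ.≤-refl
  label-≤ (e ∷ es) v = ℕ.≤-trans (merge-≤ _ _ (label es v)) (label-≤ es v)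

  NonRoot : List (Edge n) → Fin n → Set
  NonRoot es v = label es v ≢ v

  nonRoot? : ∀ es v → Dec (NonRoot es v)
  nonRoot? es v = ¬? (label es v Fin.≟ v)

  nonRoots : List (Edge n) → List (Fin n)
  nonRoots es = filter (nonRoot? es) (allFin n)

  -- This is n minus the number of components, because each component has exactly one root, its
  -- least vertex.
  rank : List (Edge n) → ℕ
  rank es = length (nonRoots es)

  nonRoots-unique : ∀ es → Unique (nonRoots es)
  nonRoots-unique es = Unique.filter⁺ (nonRoot? es) (Unique.allFin⁺ n)

  nonRoots-sorted : ∀ es → AllPairs Fin._<_ (nonRoots es)
  nonRoots-sorted es = AllPairs.filter⁺ (nonRoot? es) (AllPairs.tabulate⁺-< id)

  ∈-nonRoots⁺ : ∀ es {v} → NonRoot es v → v ∈ nonRoots es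
  ∈-nonRoots⁺ es {v} nr = ∈-filter⁺ (nonRoot? es) (∈-allFin v) nr

  ∈-nonRoots⁻ : ∀ es {v} → v ∈ nonRoots es → NonRoot es v
  ∈-nonRoots⁻ es v∈ = proj₂ (∈-filter⁻ (nonRoot? es) {xs = allFin n} v∈)

  -- A root of `bs` is a root of `as`: if `label bs v` is `v`, then `label as v` has the same
  -- `bs`-label `v`, so `v` is at most `label as v`, which is at most `v`.
  rank-spans : ∀ as bs → (∀ {e} → e ∈ as → bs spans e) → rank as ≤ rank bs
  rank-spans as bs sp = Unique-⊆-length (nonRoots-unique as) λ {v} v∈ →
    ∈-nonRoots⁺ bs λ root → ∈-nonRoots⁻ as v∈
      (Fin.≤-antisym (label-≤ as v)
        (subst (Fin._≤ label as v) (trans (sym (label-coarsens as bs sp v)) root)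
          (label-≤ bs (label as v))))

  rank-mono : ∀ as bs → as ⊆ bs → rank as ≤ rank bs
  rank-mono as bs as⊆bs = rank-spans as bs (label-joins bs ∘ as⊆bs)

  rank-∷-spanned : ∀ e es → es spans e → rank (e ∷ es) ≤ rank es
  rank-∷-spanned e es sp = rank-spans (e ∷ es) es λ where
    (here refl) → sp
    (there f∈)  → label-joins es f∈

  -- A new edge moves only the vertex `upper` of the two labels at its ends, so at most one root is
  -- lost.
  rank-∷-≤ : ∀ e es → rank (e ∷ es) ≤ suc (rank es)
  rank-∷-≤ e es = Unique-⊆-length (nonRoots-unique (e ∷ es)) sub
    where
    sub : nonRoots (e ∷ es) ⊆ upper (label es (lo e)) (label es (hi e)) ∷ nonRoots es
    sub {v} v∈ with label es v Fin.≟ v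
    ... | no nr    = there (∈-nonRoots⁺ es nr)
    ... | yes root = here (merge-moves _ _ v λ eq →
      ∈-nonRoots⁻ (e ∷ es) v∈ (trans (cong (merge _ _) root) eq))

  -- The labels at the ends of `e` are distinct roots, and the larger one stops being a root.
  rank-∷-unspanned : ∀ e es → ¬ es spans e → suc (rank es) ≤ rank (e ∷ es)
  rank-∷-unspanned e es ¬sp = Unique-⊆-length
      (All.tabulate (λ v∈ top≡v → ∈-nonRoots⁻ es v∈
          (subst (λ w → label es w ≡ w) top≡v top-root))
        ∷ nonRoots-unique es)
      sub
    where
    a = label es (lo e)
    b = label es (hi e)
    top = upper a b
    top-root : label es top ≡ top
    top-root = upper-sel (λ w → label es w ≡ w) (label-idem es (lo e)) (label-idem es (hi e))
    sub : top ∷ nonRoots es ⊆ nonRoots (e ∷ es)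
    sub (here refl) = ∈-nonRoots⁺ (e ∷ es) λ eq → ¬sp (lower≡upper⇒≡ a b
      (trans (sym (merge-upper a b)) (trans (cong (merge a b) (sym top-root)) eq)))
    sub {v} (there v∈) = ∈-nonRoots⁺ (e ∷ es) λ eq → ∈-nonRoots⁻ es v∈
      (Fin.≤-antisym (label-≤ es v) (subst (Fin._≤ label es v) eq (merge-≤ a b (label es v))))

  rank≤length : ∀ es → rank es ≤ length es
  rank≤length [] = Unique-⊆-length {ys = []} (nonRoots-unique []) λ v∈ →
    contradiction refl (∈-nonRoots⁻ [] v∈)
  rank≤length (e ∷ es) = ℕ.≤-trans (rank-∷-≤ e es) (s≤s (rank≤length es))

  label∉nonRoots : ∀ es v → All (label es v ≢_) (nonRoots es)
  label∉nonRoots es v = All.tabulate λ w∈ eq → ∈-nonRoots⁻ es w∈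
    (trans (cong (label es) (sym eq)) (trans (label-idem es v) eq))

  rank<n : ∀ es → Fin n → rank es < n
  rank<n es v = subst (suc (rank es) ≤_) (length-tabulate id) (Unique-⊆-length
    (label∉nonRoots es v ∷ nonRoots-unique es) (λ {w} _ → ∈-allFin w))

  -- Two different labels would be two roots outside `nonRoots es`, making n at least rank + 2.
  full-rank⇒label-constant : ∀ es → n ≤ suc (rank es) → ∀ u v → label es u ≡ label es v
  full-rank⇒label-constant es full u v =
    decidable-stable (label es u Fin.≟ label es v) λ u≢v →
      ℕ.<⇒≱ (subst (suc (suc (rank es)) ≤_) (length-tabulate id) (Unique-⊆-length
        ((u≢v ∷ label∉nonRoots es u) ∷ label∉nonRoots es v ∷ nonRoots-unique es)
        (λ {w} _ → ∈-allFin w))) full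

  -- Submodularity as diminishing returns, by induction on `as`: an edge that raises the rank over
  -- the larger list is not spanned by it, hence not by the smaller one, and raises the rank there
  -- too.
  rank-submodular-++ : ∀ as bs cs →
    rank (as ++ (bs ++ cs)) + rank cs ≤ rank (as ++ cs) + rank (bs ++ cs)
  rank-submodular-++ [] bs cs = ℕ.≤-reflexive (ℕ.+-comm (rank (bs ++ cs)) (rank cs))
  rank-submodular-++ (e ∷ as) bs cs with spans? (as ++ (bs ++ cs)) e
  ... | yes sp = begin
    rank (e ∷ as ++ (bs ++ cs)) + rank cs ≤⟨ ℕ.+-monoˡ-≤ _
      (rank-∷-spanned e (as ++ (bs ++ cs)) sp) ⟩
    rank (as ++ (bs ++ cs)) + rank cs     ≤⟨ rank-submodular-++ as bs cs ⟩
    rank (as ++ cs) + rank (bs ++ cs)     ≤⟨ ℕ.+-monoˡ-≤ _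
      (rank-mono (as ++ cs) (e ∷ as ++ cs) there) ⟩
    rank (e ∷ as ++ cs) + rank (bs ++ cs) ∎
    where open ℕ.≤-Reasoning
  ... | no ¬sp = begin
    rank (e ∷ as ++ (bs ++ cs)) + rank cs   ≤⟨ ℕ.+-monoˡ-≤ _ (rank-∷-≤ e (as ++ (bs ++ cs))) ⟩
    suc (rank (as ++ (bs ++ cs)) + rank cs) ≤⟨ s≤s (rank-submodular-++ as bs cs) ⟩
    suc (rank (as ++ cs) + rank (bs ++ cs)) ≤⟨ ℕ.+-monoˡ-≤ _ (rank-∷-unspanned e (as ++ cs)
      (¬sp ∘ spans-trans (as ++ cs) (as ++ (bs ++ cs)) {e}
        (label-joins (as ++ (bs ++ cs)) ∘ sub))) ⟩
    rank (e ∷ as ++ cs) + rank (bs ++ cs)   ∎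
    where
    open ℕ.≤-Reasoning
    sub : as ++ cs ⊆ as ++ (bs ++ cs)
    sub = [ ∈-++⁺ˡ , ∈-++⁺ʳ as ∘ ∈-++⁺ʳ bs ]′ ∘ ∈-++⁻ as

  -- Taking `is` as the common part `cs` repeats edges already in `as` and `bs`. This is harmless,
  -- because `rank-mono` compares lists by membership alone.
  rank-submodular : ∀ as bs us is →
    us ⊆ as ++ bs → is ⊆ as → is ⊆ bs → rank us + rank is ≤ rank as + rank bs
  rank-submodular as bs us is us⊆ is⊆as is⊆bs = begin
    rank us + rank is                 ≤⟨ ℕ.+-monoˡ-≤ _ (rank-mono us (as ++ (bs ++ is))
      ([ ∈-++⁺ˡ , ∈-++⁺ʳ as ∘ ∈-++⁺ˡ ]′ ∘ ∈-++⁻ as ∘ us⊆)) ⟩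
    rank (as ++ (bs ++ is)) + rank is ≤⟨ rank-submodular-++ as bs is ⟩
    rank (as ++ is) + rank (bs ++ is) ≤⟨ ℕ.+-mono-≤
      (rank-mono (as ++ is) as ([ id , is⊆as ]′ ∘ ∈-++⁻ as))
      (rank-mono (bs ++ is) bs ([ id , is⊆bs ]′ ∘ ∈-++⁻ bs)) ⟩
    rank as + rank bs                 ∎
    where open ℕ.≤-Reasoning

  -- Within a component, an edge uv with u < v has v ≠ root, and only one such
  -- edge at v has u = root; that edge is sent to the diagonal pair (v , v).
  length≤rankC2 : ∀ {es} → Unique es → length es ≤ suc (rank es) C 2
  length≤rankC2 {es} ues = begin
    length es                       ≡⟨ length-map code es ⟨
    length (map code es)            ≤⟨ Unique-⊆-length
      (Unique-map-∈ code-injective ues) codes⊆ ⟩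
    length (triangle (nonRoots es)) ≡⟨ length-triangle (nonRoots es) ⟩
    suc (rank es) C 2               ∎
    where
    open ℕ.≤-Reasoning
    code : Edge n → Fin n × Fin n
    code e with label es (lo e) Fin.≟ lo e
    ... | yes _ = hi e , hi e
    ... | no _  = lo e , hi e
    hi-nonRoot : ∀ {e} → e ∈ es → hi e ∈ nonRoots es
    hi-nonRoot {e} e∈ = ∈-nonRoots⁺ es λ root → ℕ.<⇒≱ (lo<hi′ e)
      (subst (Fin._≤ lo e) (trans (label-joins es e∈) root) (label-≤ es (lo e)))
    code∈ : ∀ {e} → e ∈ es → code e ∈ triangle (nonRoots es)
    code∈ {e} e∈ with label es (lo e) Fin.≟ lo e
    ... | yes _ = ∈-triangle (nonRoots-sorted es) (hi-nonRoot e∈) (hi-nonRoot e∈) ℕ.≤-refl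
    ... | no nr =
      ∈-triangle (nonRoots-sorted es) (∈-nonRoots⁺ es nr) (hi-nonRoot e∈) (ℕ.<⇒≤ (lo<hi′ e))
    codes⊆ : map code es ⊆ triangle (nonRoots es)
    codes⊆ p∈ with ∈-map⁻ code p∈
    ... | e , e∈ , refl = code∈ e∈
    code-injective : ∀ {e f} → e ∈ es → f ∈ es → code e ≡ code f → e ≡ f
    code-injective {e} {f} e∈ f∈ eq
      with label es (lo e) Fin.≟ lo e | label es (lo f) Fin.≟ lo f | ,-injective eq
    ... | yes re | yes rf | p , _ = edge-≡
          (trans (sym re) (trans (label-joins es e∈)
            (trans (cong (label es) p) (trans (sym (label-joins es f∈)) rf)))) p
    ... | yes _  | no _   | p , q = contradiction (trans (sym p) q) (Fin.<⇒≢ (lo<hi′ f))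
    ... | no _   | yes _  | p , q = contradiction (trans p (sym q)) (Fin.<⇒≢ (lo<hi′ e))
    ... | no _   | no _   | p , q = edge-≡ p q

  remove : Edge n → List (Edge n) → List (Edge n)
  remove e = filter (λ f → ¬? (f ≟ e))

  ∈-remove⁺ : ∀ {e f es} → f ∈ es → f ≢ e → f ∈ remove e es
  ∈-remove⁺ {e} = ∈-filter⁺ (λ f → ¬? (f ≟ e))

  length-remove : ∀ {e es} → e ∈ es → length (remove e es) < length es
  length-remove {e} {es} e∈ =
    filter-notAll (λ f → ¬? (f ≟ e)) es (Any.map (λ e≡f f≢e → f≢e (sym e≡f)) e∈)

  member? : ∀ (e : Edge n) es → Dec (e ∈ es)
  member? e = Any.any? (e ≟_)

T-does⁺ : ∀ {P : Set} (P? : Dec P) → P → T (does P?)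
T-does⁺ (yes _) _ = _
T-does⁺ (no ¬p) p = contradiction p ¬p

T-does⁻ : ∀ {P : Set} (P? : Dec P) → T (does P?) → P
T-does⁻ (yes p) _ = p

-- Edge sets of full rank

module Tree {n : ℕ} (L : List (Edge n)) (full : n ≤ suc (rank L)) where

  open Edge

  subgraph : SpanningSubgraph n
  subgraph e = does (member? e L)

  -- Every vertex has a walk to its label, and at full rank all labels coincide.
  subgraph-connected : Connected subgraph
  subgraph-connected u v = Walk.trans (path u) (subst (λ w → EqClosure _ w v)
      (full-rank⇒label-constant L full v u) (Walk.sym (path v)))
    where
    walks = Eq.isEquivalence (λ x y → Σ[ x<y ∈ x Fin.< y ] T (subgraph (edge x y x<y)))
    module Walk = IsEquivalence walks
    path = label-sound walks L
      λ {e} e∈ → Eq.return (lo<hi′ e , T-does⁺ (member? e L) e∈)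

  module _ (minimal : length L ≤ rank L) where

    -- Otherwise the n - 2 remaining edges would still have rank n - 1.
    remove-disconnects : ∀ {e} → e ∈ L → ¬ remove e L spans e
    remove-disconnects {e} e∈ sp = ℕ.<⇒≱ (length-remove e∈) (begin
      length L            ≤⟨ minimal ⟩
      rank L              ≤⟨ rank-spans L (remove e L) spanned ⟩
      rank (remove e L)   ≤⟨ rank≤length (remove e L) ⟩
      length (remove e L) ∎)
      where
      open ℕ.≤-Reasoning
      spanned : ∀ {f} → f ∈ L → remove e L spans f
      spanned {f} f∈ with f ≟ e
      ... | yes refl = sp
      ... | no f≢e   = label-joins (remove e L) (∈-remove⁺ f∈ f≢e)

    module _ (e : Edge n) where

      Avoids : Fin n → Set
      Avoids w = w ≢ lo e × w ≢ hi e

      edge-label : ∀ {f} → T (subgraph f) → Avoids (lo f) ⊎ Avoids (hi f) → remove e L spans f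
      edge-label {f} t av = label-joins (remove e L)
        (∈-remove⁺ (T-does⁻ (member? f L) t)
          λ { refl → [ (λ p → proj₁ p refl) , (λ p → proj₂ p refl) ]′ av })

      adjacent-label : ∀ {x y} → Adjacent subgraph x y → Avoids x ⊎ Avoids y →
        label (remove e L) x ≡ label (remove e L) y
      adjacent-label (fwd (_ , t)) av = edge-label t av
      adjacent-label (bwd (_ , t)) av = sym (edge-label t (swap av))

      -- The end `z` may be an endpoint of `e`: a step differs from `e` as soon as one of its two
      -- vertices avoids `e`.
      walk-label : ∀ {x z} xs → Linked (Adjacent subgraph) (x ∷ xs ∷ʳ z) →
        All Avoids (x ∷ xs) →
        label (remove e L) x ≡ label (remove e L) z
      walk-label []       (a ∷ _) (av ∷ _)   = adjacent-label a (inj₁ av)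
      walk-label (y ∷ ys) (a ∷ l) (av ∷ avs) =
        trans (adjacent-label a (inj₁ av)) (walk-label ys l avs)

    -- Let `e` be the first edge of a cycle. The rest of the cycle joins the ends of `e` without
    -- using it, so `remove e L` would span `e`.
    subgraph-acyclic : Acyclic subgraph
    subgraph-acyclic record { vs = [] ; long = () }
    subgraph-acyclic record { vs = _ ∷ [] ; long = s≤s () }
    subgraph-acyclic record { u = u ; vs = v ∷ w ∷ ws
                            ; distinct = (_ ∷ u∉) ∷ v∉ ∷ _
                            ; closed = uv ∷ vw ∷ walk } = closing uv
      where
      detour : ∀ e → All (Avoids e) (w ∷ ws) → label (remove e L) v ≡ label (remove e L) u
      -- The edge `vw` starts at an end of `e`, so it is told apart from `e` by `w`.
      detour e avs@(av ∷ _) = trans (adjacent-label e vw (inj₂ av)) (walk-label e ws walk avs)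
      closing : ¬ Adjacent subgraph u v
      closing (fwd (u<v , t)) = remove-disconnects {e} (T-does⁻ (member? e L) t)
        (sym (detour e (All.zipWith (λ (p , q) → p ∘ sym , q ∘ sym) (u∉ , v∉))))
        where e = edge u v u<v
      closing (bwd (v<u , t)) = remove-disconnects {e} (T-does⁻ (member? e L) t)
        (detour e (All.zipWith (λ (p , q) → p ∘ sym , q ∘ sym) (v∉ , u∉)))
        where e = edge v u v<u

-- Rado's theorem

module Rado {n k : ℕ} (c : EdgeColouring n k) (d : ℕ) where

  infixl 6 _↾_
  _↾_ : List (Edge n) → Subset k → List (Edge n)
  H ↾ S = filter (λ e → c e ∈? S) H

  ∈-↾⁺ : ∀ {e H S} → e ∈ H → c e ∈ₛ S → e ∈ H ↾ S
  ∈-↾⁺ {S = S} = ∈-filter⁺ (λ e → c e ∈? S)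

  ∈-↾⁻ : ∀ {e H S} → e ∈ H ↾ S → e ∈ H × c e ∈ₛ S
  ∈-↾⁻ {S = S} = ∈-filter⁻ (λ e → c e ∈? S)

  Deficient : List (Edge n) → Set
  Deficient H = ∃ λ S → rank (H ↾ S) < d * ∣ S ∣

  deficient? : ∀ H → Dec (Deficient H)
  deficient? H = anySubset? λ S → rank (H ↾ S) ℕ.<? d * ∣ S ∣

  Critical : List (Edge n) → Set
  Critical H = ∀ {e} → e ∈ H → Deficient (remove e H)

  -- Greedy deletion: edges are discarded as long as no deficient colour set arises. The bound `m`
  -- on the length makes the recursion structural.
  critical-sublist : ∀ m H → length H ≤ m → Unique H → ¬ Deficient H →
    ∃ λ H′ → Unique H′ × ¬ Deficient H′ × Critical H′
  critical-sublist zero    []      _    uH good = [] , uH , good , λ ()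
  critical-sublist (suc m) H |H|≤1+m uH good
    with Any.any? (λ e → ¬? (deficient? (remove e H))) H
  ... | no critical = H , uH , good , λ {e} e∈ →
        decidable-stable (deficient? (remove e H)) (critical ∘ lose e∈)
  ... | yes removable with find removable
  ...   | e , e∈ , good′ = critical-sublist m (remove e H)
          (s≤s⁻¹ (ℕ.≤-trans (length-remove e∈) |H|≤1+m))
          (Unique.filter⁺ (λ f → ¬? (f ≟ e)) uH) good′

  colourClass : Fin k → List (Edge n) → List (Edge n)
  colourClass i = filter (λ e → c e Fin.≟ i)

  module _ (H : List (Edge n)) (uH : Unique H) (good : ¬ Deficient H) where

    rank-↾-≥ : ∀ S → d * ∣ S ∣ ≤ rank (H ↾ S)
    rank-↾-≥ S = ℕ.≮⇒≥ (good ∘ (S ,_))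

    -- This is the rank condition for the single colour `i`.
    length-colourClass-≥ : ∀ i → d ≤ length (colourClass i H)
    length-colourClass-≥ i = begin
      d                        ≡⟨ ℕ.*-identityʳ d ⟨
      d * 1                    ≡⟨ cong (d *_) (∣⁅x⁆∣≡1 i) ⟨
      d * ∣ ⁅ i ⁆ ∣            ≤⟨ rank-↾-≥ ⁅ i ⁆ ⟩
      rank (H ↾ ⁅ i ⁆)         ≤⟨ rank≤length (H ↾ ⁅ i ⁆) ⟩
      length (H ↾ ⁅ i ⁆)       ≤⟨ Unique-⊆-length
        (Unique.filter⁺ (λ e → c e ∈? ⁅ i ⁆) uH) sub ⟩
      length (colourClass i H) ∎
      where
      open ℕ.≤-Reasoning
      sub : H ↾ ⁅ i ⁆ ⊆ colourClass i H
      sub e∈ = let e∈H , ce∈ = ∈-↾⁻ {H = H} e∈ in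
        ∈-filter⁺ (λ e → c e Fin.≟ i) e∈H (x∈⁅y⁆⇒x≡y i ce∈)

    module _ (critical : Critical H) (n≤1+dk : n ≤ suc (d * k)) where

      infixl 6 _∖_
      _∖_ : List (Edge n) → List (Edge n) → List (Edge n)
      es ∖ X = filter (λ e → ¬? (member? e X)) es

      ∈-∖⁺ : ∀ {e S X} → e ∈ H → c e ∈ₛ S → e ∉ X → e ∈ H ↾ S ∖ X
      ∈-∖⁺ {X = X} e∈ ce∈ = ∈-filter⁺ (λ e → ¬? (member? e X)) (∈-↾⁺ e∈ ce∈)

      ∈-∖⁻ : ∀ {e S X} → e ∈ H ↾ S ∖ X → e ∈ H × c e ∈ₛ S × e ∉ X
      ∈-∖⁻ {X = X} e∈ =
        let e∈HS , e∉X = ∈-filter⁻ (λ e → ¬? (member? e X)) e∈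
            e∈H , ce∈S = ∈-↾⁻ {H = H} e∈HS
        in e∈H , ce∈S , e∉X

      -- Each x ∈ X has a tight colour set whose rank drops when x is deleted;
      -- by submodularity these sets can be intersected one after another.
      tight-set : ∀ {i} → Fin n → ∀ X → Unique X → All (λ e → e ∈ H × c e ≡ i) X →
        ∃ λ T → i ∈ₛ T × rank (H ↾ T ∖ X) + length X ≤ d * ∣ T ∣
      -- With nothing deleted the set of all colours serves: a rank is at most n - 1, and `n≤1+dk`
      -- bounds this by dk.
      tight-set v [] _ _ = ⊤ , ∈⊤ , (begin
        rank (H ↾ ⊤ ∖ []) + 0   ≡⟨ ℕ.+-identityʳ _ ⟩
        rank (H ↾ ⊤ ∖ [])       ≤⟨ s≤s⁻¹ (ℕ.≤-trans (rank<n (H ↾ ⊤ ∖ []) v) n≤1+dk) ⟩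
        d * k                   ≡⟨ cong (d *_) (∣⊤∣≡n k) ⟨
        d * ∣ ⊤ {k} ∣           ∎)
        where open ℕ.≤-Reasoning
      tight-set {i} v (x ∷ X) (x∉X ∷ uX) ((x∈H , cx≡i) ∷ X⊆)
        with tight-set v X uX X⊆ | critical x∈H
      ... | T , i∈T , T-bound | S , S-bound =
        -- Submodularity is applied to `A` and `B`, with `U` and `I` as union and intersection. The
        -- lower bound on `rank U` cancels the term for T ∪ S, and the strictness of `S-bound`
        -- supplies the extra 1 that pays for `x`.
        T ∩ S , x∈p∩q⁺ (i∈T , i∈S) ,
        ℕ.+-cancelˡ-≤ (d * ∣ T ∪ S ∣) _ _ (begin
          d * ∣ T ∪ S ∣ + (rank I + suc q)    ≤⟨ ℕ.+-monoˡ-≤ _ (rank-↾-≥ (T ∪ S)) ⟩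
          rank U + (rank I + suc q)           ≡⟨ ℕ.+-assoc (rank U) (rank I) (suc q) ⟨
          rank U + rank I + suc q             ≤⟨ ℕ.+-monoˡ-≤ (suc q)
            (rank-submodular A B U I U⊆ I⊆A I⊆B) ⟩
          rank A + rank B + suc q             ≡⟨ cong (rank A + rank B +_) (ℕ.+-comm 1 q) ⟩
          rank A + rank B + (q + 1)           ≡⟨ interchange
            ℕ.+-commutativeSemigroup (rank A) (rank B) q 1 ⟩
          (rank A + q) + (rank B + 1)         ≡⟨ cong (rank A + q +_) (ℕ.+-comm (rank B) 1) ⟩
          (rank A + q) + suc (rank B)         ≤⟨ ℕ.+-mono-≤ T-bound S-bound ⟩
          d * ∣ T ∣ + d * ∣ S ∣               ≡⟨ ℕ.*-distribˡ-+ d ∣ T ∣ ∣ S ∣ ⟨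
          d * (∣ T ∣ + ∣ S ∣)                 ≡⟨ cong (d *_) (∣p∪q∣+∣p∩q∣≡∣p∣+∣q∣ T S) ⟨
          d * (∣ T ∪ S ∣ + ∣ T ∩ S ∣)         ≡⟨ ℕ.*-distribˡ-+ d ∣ T ∪ S ∣ ∣ T ∩ S ∣ ⟩
          d * ∣ T ∪ S ∣ + d * ∣ T ∩ S ∣       ∎)
        where
        open ℕ.≤-Reasoning
        q = length X
        A = H ↾ T ∖ X
        B = remove x H ↾ S
        U = H ↾ (T ∪ S)
        I = H ↾ (T ∩ S) ∖ (x ∷ X)
        -- If `i` were outside `S`, deleting `x` would leave `H ↾ S` unchanged, and `S` would not be
        -- deficient.
        i∈S : i ∈ₛ S
        i∈S = decidable-stable (i ∈? S) λ i∉S → ℕ.<⇒≱ S-bound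
          (ℕ.≤-trans (rank-↾-≥ S) (rank-mono (H ↾ S) B λ e∈ →
            let e∈H , ce∈S = ∈-↾⁻ {H = H} e∈ in
            ∈-↾⁺ (∈-remove⁺ e∈H λ { refl → i∉S (subst (_∈ₛ S) cx≡i ce∈S) }) ce∈S))
        -- The edge `x` is missing from `B` but lies in `A`, and the edges of `X` are missing from
        -- `A` but lie in `B`: all have colour `i`, which is in both `T` and `S`. Every other edge
        -- goes by its colour.
        U⊆ : U ⊆ A ++ B
        U⊆ {e} e∈ with ∈-↾⁻ {H = H} e∈ | e ≟ x | member? e X
        ... | e∈H , _  | yes refl | _ =
              ∈-++⁺ˡ (∈-∖⁺ e∈H (subst (_∈ₛ T) (sym cx≡i) i∈T) λ x∈X → All.lookup x∉X x∈X refl)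
        ... | e∈H , _  | no e≢x | yes e∈X = ∈-++⁺ʳ A
              (∈-↾⁺ (∈-remove⁺ e∈H e≢x) (subst (_∈ₛ S) (sym (proj₂ (All.lookup X⊆ e∈X))) i∈S))
        ... | e∈H , ce | no e≢x | no e∉X with x∈p∪q⁻ T S ce
        ...   | inj₁ ce∈T = ∈-++⁺ˡ (∈-∖⁺ e∈H ce∈T e∉X)
        ...   | inj₂ ce∈S = ∈-++⁺ʳ A (∈-↾⁺ (∈-remove⁺ e∈H e≢x) ce∈S)
        I⊆A : I ⊆ A
        I⊆A e∈ = let e∈H , ce , e∉ = ∈-∖⁻ e∈ in
          ∈-∖⁺ e∈H (proj₁ (x∈p∩q⁻ T S ce)) (e∉ ∘ there)
        I⊆B : I ⊆ B
        I⊆B e∈ = let e∈H , ce , e∉ = ∈-∖⁻ e∈ in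
          ∈-↾⁺ (∈-remove⁺ e∈H (e∉ ∘ here)) (proj₂ (x∈p∩q⁻ T S ce))

      -- `tight-set` is applied to the whole colour class. The edges with colours in `T - i` survive
      -- its deletion and already have rank at least d∣T - i∣, which leaves room for at most d.
      length-colourClass-≤ : ∀ i → Fin n → length (colourClass i H) ≤ d
      length-colourClass-≤ i v
        with tight-set {i} v (colourClass i H)
               (Unique.filter⁺ (λ e → c e Fin.≟ i) uH)
               (All.tabulate (∈-filter⁻ (λ e → c e Fin.≟ i)))
      ... | T , i∈T , bound = ℕ.+-cancelˡ-≤ (d * ∣ T - i ∣) _ _ (begin
        d * ∣ T - i ∣ + length X         ≤⟨ ℕ.+-monoˡ-≤ _ (rank-↾-≥ (T - i)) ⟩
        rank (H ↾ (T - i)) + length X    ≤⟨ ℕ.+-monoˡ-≤ _ (rank-mono _ (H ↾ T ∖ X) sub) ⟩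
        rank (H ↾ T ∖ X) + length X      ≤⟨ bound ⟩
        d * ∣ T ∣                        ≤⟨ ℕ.*-monoʳ-≤ d (∣p∣≤1+∣p-x∣ T i) ⟩
        d * suc ∣ T - i ∣                ≡⟨ ℕ.*-suc d ∣ T - i ∣ ⟩
        d + d * ∣ T - i ∣                ≡⟨ ℕ.+-comm d _ ⟩
        d * ∣ T - i ∣ + d                ∎)
        where
        open ℕ.≤-Reasoning
        X = colourClass i H
        sub : H ↾ (T - i) ⊆ H ↾ T ∖ X
        sub e∈ = let e∈H , ce∈ = ∈-↾⁻ {H = H} e∈ in
          ∈-∖⁺ e∈H (p─q⊆p T ⁅ i ⁆ ce∈) λ e∈X →
            x∉p-x T i (subst (_∈ₛ T - i)
              (proj₂ (∈-filter⁻ (λ e → c e Fin.≟ i) {xs = H} e∈X)) ce∈)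

      -- Together with rank at least dk this makes the surviving edges independent, as acyclicity
      -- requires.
      length-≤ : Fin n → length H ≤ d * k
      length-≤ v = begin
        length H                            ≤⟨ Unique-⊆-length uH (λ {e} e∈ → ∈-concatMap⁺ _
          (lose (∈-allFin (c e)) (∈-filter⁺ (λ f → c f Fin.≟ c e) e∈ refl))) ⟩
        length (concatMap class (allFin k)) ≤⟨ bound (allFin k) ⟩
        d * length (allFin k)               ≡⟨ cong (d *_) (length-tabulate id) ⟩
        d * k                               ∎
        where
        open ℕ.≤-Reasoning
        class : Fin k → List (Edge n)
        class i = colourClass i H
        bound : ∀ is → length (concatMap class is) ≤ d * length is
        bound [] = z≤n
        bound (i ∷ is) = begin
          length (class i ++ concatMap class is)        ≡⟨ length-++ (class i) ⟩
          length (class i) + length (concatMap class is) ≤⟨ ℕ.+-mono-≤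
            (length-colourClass-≤ i v) (bound is) ⟩
          d + d * length is                             ≡⟨ ℕ.*-suc d (length is) ⟨
          d * suc (length is)                           ∎

  balanced-spanning-tree : Fin n → n ≡ suc (d * k) → ¬ Deficient (edges n) →
    Σ[ H ∈ SpanningSubgraph n ] (IsSpanningTree H × ColourBalanced H c)
  balanced-spanning-tree v n≡1+dk good₀
    with critical-sublist _ (edges n) ℕ.≤-refl edges-unique good₀
  ... | L , uL , good , critical = subgraph ,
        (subgraph-connected ,
          subgraph-acyclic (ℕ.≤-trans (length-≤ L uL good critical n≤ v) dk≤rank)) ,
        λ i j → trans (count i) (sym (count j))
    where
    n≤ : n ≤ suc (d * k)
    n≤ = ℕ.≤-reflexive n≡1+dk
    dk≤rank : d * k ≤ rank L
    dk≤rank = begin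
      d * k         ≡⟨ cong (d *_) (∣⊤∣≡n k) ⟨
      d * ∣ ⊤ {k} ∣ ≤⟨ rank-↾-≥ L uL good ⊤ ⟩
      rank (L ↾ ⊤)  ≤⟨ rank-mono (L ↾ ⊤) L (proj₁ ∘ ∈-↾⁻ {H = L}) ⟩
      rank L        ∎
      where open ℕ.≤-Reasoning
    open Tree L (ℕ.≤-trans n≤ (s≤s dk≤rank))
    -- The edges counted here and the colour class of `L` are duplicate-free lists with the same
    -- members, so both bounds on the class carry over.
    count : ∀ i → #edgesOfColour subgraph c i ≡ d
    count i = ℕ.≤-antisym
      (ℕ.≤-trans
        (Unique-⊆-length (Unique.filter⁺ chosen? edges-unique) λ {e} e∈ →
          let _ , t , ce≡i = ∈-filter⁻ chosen? {xs = edges n} e∈ in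
          ∈-filter⁺ (λ e → c e Fin.≟ i) (T-does⁻ (member? e L) t) ce≡i)
        (length-colourClass-≤ L uL good critical n≤ i v))
      (ℕ.≤-trans
        (length-colourClass-≥ L uL good i)
        (Unique-⊆-length (Unique.filter⁺ (λ e → c e Fin.≟ i) uL) λ {e} e∈ →
          let e∈L , ce≡i = ∈-filter⁻ (λ e → c e Fin.≟ i) {xs = L} e∈ in
          ∈-filter⁺ chosen? (∈-edges e) (T-does⁺ (member? e L) e∈L , ce≡i)))
      where
      chosen? : ∀ e → Dec (T (subgraph e) × c e ≡ i)
      chosen? e = T? (subgraph e) ×-dec (c e Fin.≟ i)

-- Rado's theorem is used with d = 2t, so that n = dk + 1. A deficient `S` would carry too few
-- edges, since edges of rank r number at most C(r + 1, 2).
theorem1p7 : (k t : ℕ) → 1 ≤ k → 1 ≤ t →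
    (c : EdgeColouring (2 * k * t + 1) k) →
    ((j : ℕ) → 1 ≤ j → j ≤ k → (S : Subset k) → ∣ S ∣ ≡ j →
    #edgesColouredIn c S > (2 * j * t) C 2) →
    Σ[ H ∈ SpanningSubgraph (2 * k * t + 1) ]
    (IsSpanningTree H × ColourBalanced H c)
theorem1p7 k t _ _ c many = balanced-spanning-tree
    (Fin.fromℕ< {0} (ℕ.m≤n+m 1 (2 * k * t)))
    (trans (ℕ.+-comm _ 1) (cong suc (sym (reassoc k)))) good
  where
  open Rado c (2 * t)
  reassoc : ∀ j → 2 * t * j ≡ 2 * j * t
  reassoc j = trans (ℕ.*-assoc 2 t j)
    (trans (cong (2 *_) (ℕ.*-comm t j)) (sym (ℕ.*-assoc 2 j t)))
  good : ¬ Deficient (edges (2 * k * t + 1))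
  good (S , deficient) = ℕ.<⇒≱ (many ∣ S ∣ 1≤∣S∣ (∣p∣≤n S) S refl) (begin
    #edgesColouredIn c S                     ≤⟨ length≤rankC2
      (Unique.filter⁺ (λ e → c e ∈? S) edges-unique) ⟩
    -- Deficiency is strict, and this absorbs the 1 in C(r + 1, 2).
    suc (rank (edges _ ↾ S)) C 2             ≤⟨ C2-mono-≤ deficient ⟩
    (2 * t * ∣ S ∣) C 2                      ≡⟨ cong (_C 2) (reassoc ∣ S ∣) ⟩
    (2 * ∣ S ∣ * t) C 2                      ∎)
    where
    open ℕ.≤-Reasoning
    -- `many` speaks only of j at least 1; the empty set is never deficient, as no rank is below 0.
    1≤∣S∣ : 1 ≤ ∣ S ∣
    1≤∣S∣ = ℕ.n≢0⇒n>0 λ ∣S∣≡0 → case subst (rank (edges _ ↾ S) <_)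
      (trans (cong (2 * t *_) ∣S∣≡0) (ℕ.*-zeroʳ (2 * t))) deficient of λ ()
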